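{- Let $A\subseteq \mathrm{Ag}$, let $x\in\{D,T,B,4,5\}$ be a frame condition, and let $\mathsf{L}_1,\mathsf{L}_2$ be multi-agent logics without recursion operators such that $\mathsf{L}_1(\alpha)=\mathsf{L}_2(\alpha)+x$ when $\alpha\in A$ and $\mathsf{L}_1(\alpha)=\mathsf{L}_2(\alpha)$ otherwise, and $\mathsf{L}_2(\alpha)$ only includes frame conditions that precede $x$ in the fixed order $D,T,B,4,5$. For every formula $\varphi$ (without fixed-point operators), let $d=md(\varphi)$ if $x\neq 4$ and $d=md(\varphi)\cdot|\varphi|$ if $x=4$, and define $$\tau(\varphi)=\varphi\wedge Inv_d\Big(\bigwedge_{\psi\in\overline{\mathsf{sub}}(\varphi),\ \alpha\in A}\mathsf{ax}^x_\alpha[\psi/p]\Big).$$ Then $\varphi$ is $\mathsf{L}_1$-satisfiable if and only if $\tau(\varphi)$ is $\mathsf{L}_2$-satisfiable.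
   Context: Formulas (without recursion) are built from the grammar $\varphi::= p\mid\neg p\mid \mathtt{tt}\mid\mathtt{ff}\mid \varphi\wedge\varphi\mid\varphi\vee\varphi\mid\langle\alpha\rangle\varphi\mid[\alpha]\varphi$, where $p$ ranges over a finite set of propositional variables and $\alpha$ over a finite set $\mathrm{Ag}$ of agents. Negation $\neg\varphi$ of an arbitrary formula is defined by dualization (De Morgan laws, swapping $[\alpha]$ and $\langle\alpha\rangle$, $\mathtt{tt}$ and $\mathtt{ff}$), and $\varphi\to\psi$ abbreviates $\neg\varphi\vee\psi$. A Kripke model is $M=(W,R,V)$ with $W$ nonempty, $R\subseteq W\times\mathrm{Ag}\times W$ (write $R_\alpha$ for the $\alpha$-relation) and $V:W\to 2^{\mathrm{PVar}}$; $[\alpha]\varphi$ holds at $s$ iff $\varphi$ holds at all $R_\alpha$-successors of $s$, and $\langle\alpha\rangle\varphi$ iff at some $R_\alpha$-successor; the other connectives are as usual. Frame conditions on a relation: $D$ serial, $T$ reflexive, $B$ symmetric, $4$ transitive, $5$ euclidean. A single-agent logic is $\mathsf{K}$ plus a set of these conditions; $\mathsf{L}+c$ adds condition $c$. A multi-agent logic $\mathsf{L}$ on $\mathrm{Ag}$ assigns to each agent $\alpha$ a single-agent logic $\mathsf{L}(\alpha)$; its models are the Kripke models in which each $R_\alpha$ satisfies all conditions of $\mathsf{L}(\alpha)$. A formula is $\mathsf{L}$-satisfiable if it is true at some state of some model of $\mathsf{L}$. The modal depth $md$ is defined by $md(p)=md(\neg p)=md(\mathtt{tt})=md(\mathtt{ff})=0$,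 $md(\varphi\wedge\psi)=md(\varphi\vee\psi)=\max(md(\varphi),md(\psi))$, $md([\alpha]\varphi)=md(\langle\alpha\rangle\varphi)=1+md(\varphi)$. $\mathsf{sub}(\varphi)$ is the set of subformulas of $\varphi$, $|\varphi|=|\mathsf{sub}(\varphi)|$, and $\overline{\mathsf{sub}}(\varphi)=\mathsf{sub}(\varphi)\cup\{\neg\psi:\psi\in\mathsf{sub}(\varphi)\}$. $[\mathrm{Ag}]\chi$ abbreviates $\bigwedge_{\alpha\in\mathrm{Ag}}[\alpha]\chi$, $[\mathrm{Ag}]^i$ is its $i$-fold iteration, and $Inv_d(\chi)=\bigwedge_{i\le d}[\mathrm{Ag}]^i\chi$. The axioms are: $\mathsf{ax}^D_\alpha=\langle\alpha\rangle\mathtt{tt}$, $\mathsf{ax}^T_\alpha=[\alpha]p\to p$, $\mathsf{ax}^B_\alpha=\langle\alpha\rangle[\alpha]p\to p$, $\mathsf{ax}^4_\alpha=[\alpha]p\to[\alpha][\alpha]p$, $\mathsf{ax}^5_\alpha=\langle\alpha\rangle[\alpha]p\to[\alpha]p$, and $\mathsf{ax}^x_\alpha[\psi/p]$ denotes substitution of $\psi$ for $p$. -}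

module Defs where

open import Level using (0ℓ)
open import Data.Bool using (Bool; true; false; _∧_; _∨_; if_then_else_)
open import Data.Nat using (ℕ; zero; suc; _*_; _<_; _⊔_)
open import Data.Fin using (Fin)
import Data.Fin as Fin
open import Data.List using (List; []; _∷_; _++_; map; foldr; filter; length; allFin; deduplicateᵇ; concatMap; upTo)
open import Data.Product using (Σ; _×_; ∃)
open import Relation.Binary.PropositionalEquality using (_≡_)
open import Relation.Nullary using (¬_)
open import Data.Bool using (T?)

-- Syntax. Agents Ag = Fin k, propositional variables PVar = Fin n.

data Form (k n : ℕ) : Set where
  var  : Fin n → Form k n
  nvar : Fin n → Form k n
  tt   : Form k n
  ff   : Form k n
  _∧ᶠ_ : Form k n → Form k n → Form k n
  _∨ᶠ_ : Form k n → Form k n → Form k n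
  ⟨_⟩_ : Fin k → Form k n → Form k n
  [_]_ : Fin k → Form k n → Form k n

eqF : {m : ℕ} → Fin m → Fin m → Bool
eqF i j = Data.Nat._≡ᵇ_ (Fin.toℕ i) (Fin.toℕ j)

module _ {k n : ℕ} where

  neg : Form k n → Form k n
  neg (var p) = nvar p
  neg (nvar p) = var p
  neg tt = ff
  neg ff = tt
  neg (φ ∧ᶠ ψ) = neg φ ∨ᶠ neg ψ
  neg (φ ∨ᶠ ψ) = neg φ ∧ᶠ neg ψ
  neg (⟨ α ⟩ φ) = [ α ] neg φ
  neg ([ α ] φ) = ⟨ α ⟩ neg φ

  _⇒ᶠ_ : Form k n → Form k n → Form k n
  φ ⇒ᶠ ψ = neg φ ∨ᶠ ψ

  md : Form k n → ℕ
  md (var _) = 0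
  md (nvar _) = 0
  md tt = 0
  md ff = 0
  md (φ ∧ᶠ ψ) = md φ ⊔ md ψ
  md (φ ∨ᶠ ψ) = md φ ⊔ md ψ
  md (⟨ _ ⟩ φ) = suc (md φ)
  md ([ _ ] φ) = suc (md φ)

  _==_ : Form k n → Form k n → Bool
  var p == var q = eqF p q
  nvar p == nvar q = eqF p q
  tt == tt = true
  ff == ff = true
  (φ ∧ᶠ ψ) == (φ' ∧ᶠ ψ') = (φ == φ') ∧ (ψ == ψ')
  (φ ∨ᶠ ψ) == (φ' ∨ᶠ ψ') = (φ == φ') ∧ (ψ == ψ')
  (⟨ α ⟩ φ) == (⟨ β ⟩ ψ) = eqF α β ∧ (φ == ψ)
  ([ α ] φ) == ([ β ] ψ) = eqF α β ∧ (φ == ψ)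
  _ == _ = false

  subL : Form k n → List (Form k n)
  subL φ@(var _) = φ ∷ []
  subL φ@(nvar _) = φ ∷ []
  subL tt = tt ∷ []
  subL ff = ff ∷ []
  subL φ@(ψ ∧ᶠ χ) = φ ∷ subL ψ ++ subL χ
  subL φ@(ψ ∨ᶠ χ) = φ ∷ subL ψ ++ subL χ
  subL φ@(⟨ _ ⟩ ψ) = φ ∷ subL ψ
  subL φ@([ _ ] ψ) = φ ∷ subL ψ

  sub : Form k n → List (Form k n)
  sub φ = deduplicateᵇ _==_ (subL φ)

  size : Form k n → ℕ
  size φ = length (sub φ)

  subBar : Form k n → List (Form k n)
  subBar φ = sub φ ++ map neg (sub φ)

  ⋀ : List (Form k n) → Form k n
  ⋀ = foldr _∧ᶠ_ tt

  [Ag]_ : Form k n → Form k n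
  [Ag] χ = ⋀ (map (λ α → [ α ] χ) (allFin k))

  [Ag]^ : ℕ → Form k n → Form k n
  [Ag]^ zero χ = χ
  [Ag]^ (suc i) χ = [Ag] ([Ag]^ i χ)

  Inv : ℕ → Form k n → Form k n
  Inv d χ = ⋀ (map (λ i → [Ag]^ i χ) (upTo (suc d)))

data Cond : Set where
  D T B C4 C5 : Cond

rank : Cond → ℕ
rank D = 0
rank T = 1
rank B = 2
rank C4 = 3
rank C5 = 4

_precedes_ : Cond → Cond → Set
c precedes x = rank c < rank x

_==ᶜ_ : Cond → Cond → Bool
c ==ᶜ x = Data.Nat._≡ᵇ_ (rank c) (rank x)

ax : {k n : ℕ} → Cond → Fin k → Form k n → Form k n
ax D α ψ = ⟨ α ⟩ tt
ax T α ψ = ([ α ] ψ) ⇒ᶠ ψ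
ax B α ψ = (⟨ α ⟩ ([ α ] ψ)) ⇒ᶠ ψ
ax C4 α ψ = ([ α ] ψ) ⇒ᶠ ([ α ] ([ α ] ψ))
ax C5 α ψ = (⟨ α ⟩ ([ α ] ψ)) ⇒ᶠ ([ α ] ψ)

-- A ⊆ Ag as a characteristic function
Agents : ℕ → Set
Agents k = Fin k → Bool

depthBound : {k n : ℕ} → Cond → Form k n → ℕ
depthBound C4 φ = md φ * size φ
depthBound D φ = md φ
depthBound T φ = md φ
depthBound B φ = md φ
depthBound C5 φ = md φ

τ : {k n : ℕ} → Agents k → Cond → Form k n → Form k n
τ {k} A x φ = φ ∧ᶠ Inv d (⋀ (concatMap (λ ψ → map (λ α → ax x α ψ) (filter (λ α → T? (A α)) (allFin k))) (subBar φ)))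
  where
  d : ℕ
  d = depthBound x φ

record Model (k n : ℕ) : Set₁ where
  field
    W : Set
    R : Fin k → W → W → Set
    V : W → Fin n → Bool

module _ {k n : ℕ} (M : Model k n) where
  open Model M

  _⊨_ : W → Form k n → Set
  w ⊨ var p = V w p ≡ true
  w ⊨ nvar p = V w p ≡ false
  w ⊨ tt = ⊤' where open import Data.Unit renaming (⊤ to ⊤')
  w ⊨ ff = ⊥' where open import Data.Empty renaming (⊥ to ⊥')
  w ⊨ (φ ∧ᶠ ψ) = (w ⊨ φ) × (w ⊨ ψ)
  w ⊨ (φ ∨ᶠ ψ) = (w ⊨ φ) ⊎ (w ⊨ ψ) where open import Data.Sum using (_⊎_)
  w ⊨ (⟨ α ⟩ φ) = Σ W λ v → R α w v × (v ⊨ φ)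
  w ⊨ ([ α ] φ) = ∀ v → R α w v → v ⊨ φ

Holds : {W : Set} → Cond → (W → W → Set) → Set
Holds {W} D r = ∀ w → Σ W λ v → r w v
Holds T r = ∀ w → r w w
Holds B r = ∀ w v → r w v → r v w
Holds C4 r = ∀ w v u → r w v → r v u → r w u
Holds C5 r = ∀ w v u → r w v → r w u → r v u

-- multi-agent logic: for each agent, the set of frame conditions it includes
Logic : ℕ → Set
Logic k = Fin k → Cond → Bool

IsModelOf : {k n : ℕ} → Logic k → Model k n → Set
IsModelOf L M = ∀ α c → L α c ≡ true → Holds c (Model.R M α)

Satisfiable : {k n : ℕ} → Logic k → Form k n → Set₁
Satisfiable {k} {n} L φ = Σ (Model k n) λ M → IsModelOf L M × Σ (Model.W M) λ w → _⊨_ M w φ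

{-# OPTIONS --safe #-}
module Submission where

-- Every model of L₁ is a model of L₂ in which the axioms are valid.  Conversely, take a state s
-- of an L₂-model M satisfying τ(φ), and replace the relation of each agent α by one that is as
-- large as preservation of the formulas [α]ψ ∈ sub(φ) allows, so that the frame condition x
-- holds by construction, on copies (l , w) of the worlds of M.  Here l bounds the modal depth of
-- the formulas that must stay true at the copy, and w comes with a budget: the number of further
-- steps in M within which the axioms are known to hold.  As formulas are in negation normal form,
-- truth only has to be preserved from M to the new model; the axioms ensure that the new relation
-- still contains witnesses for all diamonds.
--
-- For x ≠ 4 the budget at level l is l.  For x = 4 it is l |φ|: along a run of α-edges the set of
-- true formulas [α]ψ only grows, so it grows fewer than |φ| times.  While it is constant, no budget is
-- spent, because a fixed world r (the anchor of the run) provides the witnesses for all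
-- later points: by the axiom for ¬ψ, a later ⟨α⟩ψ already holds at r.

open import Defs
open import Level using (0ℓ)
open import Axiom.ExcludedMiddle using (ExcludedMiddle)
open import Data.Nat using (ℕ; zero; suc; _+_; _*_; _≤_; _<_; z≤n; s≤s; s≤s⁻¹; pred; _⊔_)
open import Data.Bool using (true; false; _∨_; T?; _∧_) renaming (T to True)
open import Data.Product using (Σ; ∃; _×_; _,_; proj₁; proj₂)
open import Relation.Binary.PropositionalEquality using (_≡_; _≢_; refl; sym; trans; cong; cong₂; subst)
open import Data.Bool.Properties using (T-∧; T-≡; T-∨; ∨-zeroʳ; ¬-not)
open import Data.Empty using (⊥; ⊥-elim)
open import Data.Fin using (Fin; _≟_)
open import Data.Fin.Properties using (toℕ-injective)
open import Data.List using (List; []; _∷_; _++_; map; filter; length; allFin; concatMap; upTo)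
open import Data.List.Properties using (filter-notAll)
open import Data.List.Membership.Propositional using (_∈_; find; lose)
open import Data.List.Membership.Propositional.Properties
  using (∈-map⁺; ∈-map⁻; ∈-++⁺ˡ; ∈-++⁺ʳ; ∈-concatMap⁺; ∈-concatMap⁻;
         ∈-filter⁺; ∈-filter⁻; ∈-upTo⁺; ∈-allFin)
open import Data.List.Relation.Unary.Any as Any using (Any; here; there)
import Data.List.Relation.Unary.Any.Properties as AnyP
open import Data.Nat.Properties
  using (≡ᵇ⇒≡; ≤-refl; ≤-reflexive; ≤-trans; m≤n⇒m≤1+n; m≤m+n; m≤n+m; +-monoʳ-≤; +-suc; +-comm;
         m⊔n≤o⇒m≤o; m⊔n≤o⇒n≤o; n≤1+n; <-irrefl; <⇒≤; pred-mono-≤)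
open import Data.Sum using (_⊎_; inj₁; inj₂; [_,_]′)
open import Data.Unit using (tt)
open import Function using (_∘_; id; case_of_)
open import Function.Bundles using (Equivalence)
open import Relation.Nullary using (¬_; Dec; yes; no; contradiction)

-- Subformulas

module _ {k n : ℕ} where

  neg-involutive : (ψ : Form k n) → neg (neg ψ) ≡ ψ
  neg-involutive (var p) = refl
  neg-involutive (nvar p) = refl
  neg-involutive tt = refl
  neg-involutive ff = refl
  neg-involutive (ψ ∧ᶠ χ) = cong₂ _∧ᶠ_ (neg-involutive ψ) (neg-involutive χ)
  neg-involutive (ψ ∨ᶠ χ) = cong₂ _∨ᶠ_ (neg-involutive ψ) (neg-involutive χ)
  neg-involutive (⟨ α ⟩ ψ) = cong (⟨ α ⟩_) (neg-involutive ψ)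
  neg-involutive ([ α ] ψ) = cong ([ α ]_) (neg-involutive ψ)

  eqF-sound : ∀ {m} (i j : Fin m) → True (eqF i j) → i ≡ j
  eqF-sound i j = toℕ-injective ∘ ≡ᵇ⇒≡ _ _

  ∧-split : ∀ {a b} → True (a ∧ b) → True a × True b
  ∧-split = Equivalence.to T-∧

  ==-sound : (ψ χ : Form k n) → True (ψ == χ) → ψ ≡ χ
  ==-sound (var p) (var q) t = cong var (eqF-sound p q t)
  ==-sound (nvar p) (nvar q) t = cong nvar (eqF-sound p q t)
  ==-sound tt tt _ = refl
  ==-sound ff ff _ = refl
  ==-sound (ψ ∧ᶠ χ) (ψ′ ∧ᶠ χ′) t with ∧-split t
  ... | a , b = cong₂ _∧ᶠ_ (==-sound ψ ψ′ a) (==-sound χ χ′ b)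
  ==-sound (ψ ∨ᶠ χ) (ψ′ ∨ᶠ χ′) t with ∧-split t
  ... | a , b = cong₂ _∨ᶠ_ (==-sound ψ ψ′ a) (==-sound χ χ′ b)
  ==-sound (⟨ α ⟩ ψ) (⟨ β ⟩ χ) t with ∧-split t
  ... | a , b = cong₂ ⟨_⟩_ (eqF-sound α β a) (==-sound ψ χ b)
  ==-sound ([ α ] ψ) ([ β ] χ) t with ∧-split t
  ... | a , b = cong₂ [_]_ (eqF-sound α β a) (==-sound ψ χ b)

  subL⊆sub : (φ : Form k n) → ∀ {χ} → χ ∈ subL φ → χ ∈ sub φ
  subL⊆sub φ = AnyP.deduplicate⁺ (λ ψ χ → T? (ψ == χ)) (λ {ψ} {χ} t e → trans e (sym (==-sound χ ψ t)))

  subL-refl : (φ : Form k n) → φ ∈ subL φ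
  subL-refl (var _) = here refl
  subL-refl (nvar _) = here refl
  subL-refl tt = here refl
  subL-refl ff = here refl
  subL-refl (_ ∧ᶠ _) = here refl
  subL-refl (_ ∨ᶠ _) = here refl
  subL-refl (⟨ _ ⟩ _) = here refl
  subL-refl ([ _ ] _) = here refl

  data NonModal : Form k n → Set where
    var  : ∀ p → NonModal (var p)
    nvar : ∀ p → NonModal (nvar p)
    tt   : NonModal tt
    ff   : NonModal ff

  -- Following first arguments leads down to a leaf. The leaf is a subformula that is not a box, so
  -- fewer than |φ| boxes ever need counting.
  nonModal-subL : (φ : Form k n) → Any NonModal (subL φ)
  nonModal-subL (var p) = here (var p)
  nonModal-subL (nvar p) = here (nvar p)
  nonModal-subL tt = here tt
  nonModal-subL ff = here ff
  nonModal-subL (ψ ∧ᶠ χ) = there (AnyP.++⁺ˡ (nonModal-subL ψ))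
  nonModal-subL (ψ ∨ᶠ χ) = there (AnyP.++⁺ˡ (nonModal-subL ψ))
  nonModal-subL (⟨ _ ⟩ ψ) = there (nonModal-subL ψ)
  nonModal-subL ([ _ ] ψ) = there (nonModal-subL ψ)

  nonModal-sub : (φ : Form k n) → Any NonModal (sub φ)
  nonModal-sub φ with find (nonModal-subL φ)
  ... | _ , m , p = lose (subL⊆sub φ m) p

==ᶜ-sound : ∀ c d → True (c ==ᶜ d) → c ≡ d
==ᶜ-sound D D _ = refl
==ᶜ-sound T T _ = refl
==ᶜ-sound B B _ = refl
==ᶜ-sound C4 C4 _ = refl
==ᶜ-sound C5 C5 _ = refl

==ᶜ-refl : ∀ c → (c ==ᶜ c) ≡ true
==ᶜ-refl D = refl
==ᶜ-refl T = refl
==ᶜ-refl B = refl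
==ᶜ-refl C4 = refl
==ᶜ-refl C5 = refl

filter-⊂ : ∀ {A : Set} {P Q : A → Set} (P? : ∀ a → Dec (P a)) (Q? : ∀ a → Dec (Q a)) xs →
  (∀ a → P a → Q a) → Any (λ a → Q a × ¬ P a) xs → length (filter P? xs) < length (filter Q? xs)
filter-⊂ {P = P} {Q} P? Q? xs P⊆Q = go xs
  where
  mono : ∀ xs → length (filter P? xs) ≤ length (filter Q? xs)
  mono [] = z≤n
  mono (x ∷ xs) with P? x | Q? x
  ... | yes _ | yes _ = s≤s (mono xs)
  ... | yes p | no ¬q = contradiction (P⊆Q x p) ¬q
  ... | no _  | yes _ = m≤n⇒m≤1+n (mono xs)
  ... | no _  | no _  = mono xs
  go : ∀ xs → Any (λ a → Q a × ¬ P a) xs → length (filter P? xs) < length (filter Q? xs)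
  go (x ∷ xs) (here (q , ¬p)) with P? x | Q? x
  ... | yes p | _     = contradiction p ¬p
  ... | no _  | yes _ = s≤s (mono xs)
  ... | no _  | no ¬q = contradiction q ¬q
  go (x ∷ xs) (there any) with P? x | Q? x
  ... | yes _ | yes _ = s≤s (go xs any)
  ... | yes p | no ¬q = contradiction (P⊆Q x p) ¬q
  ... | no _  | yes _ = m≤n⇒m≤1+n (go xs any)
  ... | no _  | no _  = go xs any

-- Classical semantics

module Classical (em : ExcludedMiddle 0ℓ) {k n : ℕ} (M : Model k n) where
  open Model M

  infix 4 _⊩_
  _⊩_ : W → Form k n → Set
  _⊩_ = _⊨_ M

  ⊩-contradiction : ∀ ψ {w} → w ⊩ ψ → w ⊩ neg ψ → ⊥
  ⊩-contradiction (var p) a b = case trans (sym a) b of λ ()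
  ⊩-contradiction (nvar p) a b = case trans (sym a) b of λ ()
  ⊩-contradiction ff () _
  ⊩-contradiction (ψ ∧ᶠ χ) (a , b) = [ ⊩-contradiction ψ a , ⊩-contradiction χ b ]′
  ⊩-contradiction (ψ ∨ᶠ χ) (inj₁ a) (b , _) = ⊩-contradiction ψ a b
  ⊩-contradiction (ψ ∨ᶠ χ) (inj₂ a) (_ , b) = ⊩-contradiction χ a b
  ⊩-contradiction (⟨ α ⟩ ψ) (v , r , a) b = ⊩-contradiction ψ a (b v r)
  ⊩-contradiction ([ α ] ψ) a (v , r , b) = ⊩-contradiction ψ (a v r) b

  ⊩-em : ∀ ψ w → (w ⊩ ψ) ⊎ (w ⊩ neg ψ)
  ⊩-em (var p) w with V w p
  ... | true = inj₁ refl
  ... | false = inj₂ refl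
  ⊩-em (nvar p) w with V w p
  ... | true = inj₂ refl
  ... | false = inj₁ refl
  ⊩-em tt w = inj₁ tt
  ⊩-em ff w = inj₂ tt
  ⊩-em (ψ ∧ᶠ χ) w with ⊩-em ψ w | ⊩-em χ w
  ... | inj₁ a | inj₁ b = inj₁ (a , b)
  ... | inj₂ a | _      = inj₂ (inj₁ a)
  ... | inj₁ _ | inj₂ b = inj₂ (inj₂ b)
  ⊩-em (ψ ∨ᶠ χ) w with ⊩-em ψ w | ⊩-em χ w
  ... | inj₁ a | _      = inj₁ (inj₁ a)
  ... | inj₂ _ | inj₁ b = inj₁ (inj₂ b)
  ... | inj₂ a | inj₂ b = inj₂ (a , b)
  ⊩-em (⟨ α ⟩ ψ) w with em {w ⊩ ⟨ α ⟩ ψ}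
  ... | yes a = inj₁ a
  ... | no ¬a = inj₂ λ v r → [ (λ a → ⊥-elim (¬a (v , r , a))) , id ]′ (⊩-em ψ v)
  ⊩-em ([ α ] ψ) w with em {w ⊩ ⟨ α ⟩ neg ψ}
  ... | yes a = inj₂ a
  ... | no ¬a = inj₁ λ v r → [ id , (λ a → ⊥-elim (¬a (v , r , a))) ]′ (⊩-em ψ v)

  ⇒-intro : ∀ ψ χ {w} → (w ⊩ ψ → w ⊩ χ) → w ⊩ (ψ ⇒ᶠ χ)
  ⇒-intro ψ χ {w} f = [ inj₂ ∘ f , inj₁ ]′ (⊩-em ψ w)

  ⇒-elim : ∀ ψ χ {w} → w ⊩ (ψ ⇒ᶠ χ) → w ⊩ ψ → w ⊩ χ
  ⇒-elim ψ χ f a = [ ⊥-elim ∘ ⊩-contradiction ψ a , id ]′ f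

  ⋀-intro : ∀ xs {w} → (∀ {χ} → χ ∈ xs → w ⊩ χ) → w ⊩ ⋀ xs
  ⋀-intro [] f = tt
  ⋀-intro (χ ∷ xs) f = f (here refl) , ⋀-intro xs (f ∘ there)

  ⋀-elim : ∀ xs {w χ} → w ⊩ ⋀ xs → χ ∈ xs → w ⊩ χ
  ⋀-elim (χ ∷ xs) (a , _) (here refl) = a
  ⋀-elim (χ ∷ xs) (_ , b) (there i) = ⋀-elim xs b i

  ⋀-map-intro : ∀ {A : Set} (f : A → Form k n) xs {w} → (∀ a → w ⊩ f a) → w ⊩ ⋀ (map f xs)
  ⋀-map-intro f xs h = ⋀-intro (map f xs) λ m → case ∈-map⁻ f m of λ where
    (a , _ , refl) → h a

  ⋀-map-elim : ∀ {A : Set} (f : A → Form k n) xs {w a} → w ⊩ ⋀ (map f xs) → a ∈ xs → w ⊩ f a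
  ⋀-map-elim f xs h m = ⋀-elim (map f xs) h (∈-map⁺ f m)

  valid-[Ag]^ : ∀ i {χ} → (∀ w → w ⊩ χ) → ∀ w → w ⊩ [Ag]^ i χ
  valid-[Ag]^ zero h w = h w
  valid-[Ag]^ (suc i) {χ} h w =
    ⋀-map-intro (λ α → [ α ] [Ag]^ i χ) (allFin k) λ α v _ → valid-[Ag]^ i h v

  valid-Inv : ∀ d {χ} → (∀ w → w ⊩ χ) → ∀ w → w ⊩ Inv d χ
  valid-Inv d {χ} h w = ⋀-map-intro (λ i → [Ag]^ i χ) (upTo (suc d)) λ i → valid-[Ag]^ i h w

  -- The semantic content of `Inv j`, along paths whose agents may change at every step. In this
  -- inductive form each step in M costs exactly one unit.
  data Near (P : W → Set) : ℕ → W → Set where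
    stop : ∀ {w} → P w → Near P zero w
    more : ∀ {j w} → P w → (∀ {α v} → R α w v → Near P j v) → Near P (suc j) w

  Near-now : ∀ {P j w} → Near P j w → P w
  Near-now (stop a) = a
  Near-now (more a _) = a

  Near-step : ∀ {P j α w v} → Near P (suc j) w → R α w v → Near P j v
  Near-step (more _ h) = h

  Near-≤ : ∀ {P i j} → i ≤ j → ∀ {w} → Near P j w → Near P i w
  Near-≤ z≤n h = stop (Near-now h)
  Near-≤ (s≤s i≤j) (more a h) = more a λ r → Near-≤ i≤j (h r)

  Near-Inv : ∀ d {χ w} → w ⊩ Inv d χ → Near (_⊩ χ) d w
  Near-Inv d {χ} h = go d λ i≤d → ⋀-map-elim (λ i → [Ag]^ i χ) (upTo (suc d)) h (∈-upTo⁺ (s≤s i≤d))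
    where
    go : ∀ d {w} → (∀ {i} → i ≤ d → w ⊩ [Ag]^ i χ) → Near (_⊩ χ) d w
    go zero f = stop (f z≤n)
    go (suc d) f = more (f z≤n) λ {α} {v} r → go d λ {i} i≤d →
      ⋀-map-elim (λ α → [ α ] [Ag]^ i χ) (allFin k) (f (s≤s i≤d)) (∈-allFin α) v r

  Near-map : ∀ {P Q : W → Set} {j} → (∀ {w} → P w → Q w) → ∀ {w} → Near P j w → Near Q j w
  Near-map f (stop a) = stop (f a)
  Near-map f (more a h) = more (f a) λ r → Near-map f (h r)

  -- Contrapositive of axiom 5 for `neg χ`: a successor v without `⟨ α ⟩ χ` satisfies `[ α ] neg χ`,
  -- which then holds at w and refutes the witness u. Instances for negated subformulas enter in
  -- this way.
  dual-5 : ∀ {α} χ {w} → w ⊩ ax C5 α (neg χ) → w ⊩ ⟨ α ⟩ χ → w ⊩ [ α ] (⟨ α ⟩ χ)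
  dual-5 {α} χ h (u , ru , c) v rv with ⊩-em (⟨ α ⟩ χ) v
  ... | inj₁ a = a
  ... | inj₂ b = ⊥-elim (⊩-contradiction χ c (⇒-elim (⟨ α ⟩ [ α ] neg χ) ([ α ] neg χ) h (v , rv , b) u ru))

  dual-4 : ∀ {α} χ {w} → w ⊩ ax C4 α (neg χ) → w ⊩ ⟨ α ⟩ (⟨ α ⟩ χ) → w ⊩ ⟨ α ⟩ χ
  dual-4 {α} χ {w} h (v , rv , u , ru , c) with ⊩-em (⟨ α ⟩ χ) w
  ... | inj₁ a = a
  ... | inj₂ b = ⊥-elim (⊩-contradiction χ c (⇒-elim ([ α ] neg χ) ([ α ] [ α ] neg χ) h b v rv u ru))

  ax-valid : ∀ x α χ → Holds x (R α) → ∀ w → w ⊩ ax x α χ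
  ax-valid D α χ h w = let v , r = h w in v , r , tt
  ax-valid T α χ h w = ⇒-intro ([ α ] χ) χ λ a → a w (h w)
  ax-valid B α χ h w = ⇒-intro (⟨ α ⟩ [ α ] χ) χ λ (v , r , a) → a w (h w v r)
  ax-valid C4 α χ h w = ⇒-intro ([ α ] χ) ([ α ] [ α ] χ) λ a v r u s → a u (h w v u r s)
  ax-valid C5 α χ h w = ⇒-intro (⟨ α ⟩ [ α ] χ) ([ α ] χ) λ (v , r , a) u s → a u (h w v u r s)

  Axioms : Agents k → Cond → Form k n → W → Set
  Axioms A x φ w = ∀ α χ → A α ≡ true → χ ∈ subBar φ → w ⊩ ax x α χ

  members : Agents k → List (Fin k)
  members A = filter (λ α → T? (A α)) (allFin k)

  instances : Agents k → Cond → Form k n → List (Form k n)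
  instances A x ψ = map (λ α → ax x α ψ) (members A)

  τ-intro : ∀ A x φ {w} → w ⊩ φ → (∀ v → Axioms A x φ v) → w ⊩ τ A x φ
  τ-intro A x φ {w} a h =
    a , valid-Inv (depthBound x φ) (λ v → ⋀-intro (concatMap (instances A x) (subBar φ)) (valid v)) w
    where
    valid : ∀ v {χ} → χ ∈ concatMap (instances A x) (subBar φ) → v ⊩ χ
    valid v m with find (∈-concatMap⁻ (instances A x) {xs = subBar φ} m)
    ... | ψ , ψ∈ , m′ with ∈-map⁻ (λ α → ax x α ψ) m′
    ... | α , α∈ , refl =
      h v α ψ (Equivalence.to T-≡ (proj₂ (∈-filter⁻ (λ α → T? (A α)) {xs = allFin k} α∈))) ψ∈

  τ-elim : ∀ A x φ {w} → w ⊩ τ A x φ → (w ⊩ φ) × Near (Axioms A x φ) (depthBound x φ) w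
  τ-elim A x φ (a , h) = a , Near-map (λ c α χ Aα χ∈ →
      ⋀-elim (concatMap (instances A x) (subBar φ)) c (∈-concatMap⁺ (instances A x)
        (lose χ∈ (∈-map⁺ (λ α → ax x α χ)
          (∈-filter⁺ (λ α → T? (A α)) (∈-allFin α) (Equivalence.from T-≡ Aα)))))) (Near-Inv (depthBound x φ) h)

-- Gluing single-agent frames

module Glue {k n : ℕ} (M : Model k n) (Γ : List (Form k n)) (L : Logic k)
            (Budget : ℕ → Model.W M → Set) where
  open Model M

  private
    infix 4 _⊩_
    _⊩_ : W → Form k n → Set
    _⊩_ = _⊨_ M

  Boxed : Fin k → Form k n → Set
  Boxed α ψ = [ α ] ψ ∈ Γ × ψ ∈ Γ

  -- tt is included so that seriality is an instance of diamond witnessing.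
  Requested : Fin k → Form k n → Set
  Requested α ψ = (ψ ≡ tt) ⊎ (⟨ α ⟩ ψ ∈ Γ × ψ ∈ Γ)

  -- A frame for one agent over copies of the worlds of M.  A point of level l
  -- over w only has to satisfy the formulas of Γ of modal depth at most l that hold at w in M.
  record AgentFrame (α : Fin k) : Set₁ where
    field
      Point    : Set
      level    : Point → ℕ
      world    : Point → W
      Edge     : Point → Point → Set
      budget   : ∀ p → Budget (level p) (world p)
      start    : ∀ {l w} → Budget l w → Point
      level-start : ∀ {l w} (b : Budget l w) → level (start b) ≡ l
      world-start : ∀ {l w} (b : Budget l w) → world (start b) ≡ w
      frame    : ∀ c → L α c ≡ true → Holds c Edge
      box      : ∀ {p q ψ} → Edge p q → Boxed α ψ → suc (md ψ) ≤ level p →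
                 world p ⊩ [ α ] ψ → (world q ⊩ ψ) × md ψ ≤ level q
      diamond  : ∀ p {ψ} → Requested α ψ → suc (md ψ) ≤ level p → world p ⊩ ⟨ α ⟩ ψ →
                 Σ Point λ q → Edge p q × (world q ⊩ ψ) × md ψ ≤ level q

  module _ (F : ∀ α → AgentFrame α) where
    open AgentFrame

    data State : Set where
      free : ∀ {l w} → Budget l w → State
      on   : ∀ α → Point (F α) → State

    levelˢ : State → ℕ
    levelˢ (free {l} _) = l
    levelˢ (on α p) = level (F α) p

    worldˢ : State → W
    worldˢ (free {_} {w} _) = w
    worldˢ (on α p) = world (F α) p

    -- A state of agent α keeps its point, and with it the history of the run, only in the frame of
    -- α; every other agent sees a fresh start with the remaining budget.
    view : ∀ α → State → Point (F α)
    view α (free b) = start (F α) b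
    view α (on β p) with β ≟ α
    ... | yes refl = p
    ... | no _     = start (F α) (budget (F β) p)

    level-view : ∀ α σ → level (F α) (view α σ) ≡ levelˢ σ
    level-view α (free b) = level-start (F α) b
    level-view α (on β p) with β ≟ α
    ... | yes refl = refl
    ... | no _     = level-start (F α) (budget (F β) p)

    world-view : ∀ α σ → world (F α) (view α σ) ≡ worldˢ σ
    world-view α (free b) = world-start (F α) b
    world-view α (on β p) with β ≟ α
    ... | yes refl = refl
    ... | no _     = world-start (F α) (budget (F β) p)

    view-on : ∀ α p → view α (on α p) ≡ p
    view-on α p with α ≟ α
    ... | yes refl = refl
    ... | no α≢α   = contradiction refl α≢α

    glued : Model k n
    glued = record { W = State ; R = λ α σ σ′ → Edge (F α) (view α σ) (view α σ′) ; V = V ∘ worldˢ }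

    -- T, B, 4 and 5 are universal, so they survive pulling the edges back along `view`. Seriality
    -- needs a state with a prescribed view, and `on α q` is one.
    glued-isModel : IsModelOf L glued
    glued-isModel α D h σ = let q , e = frame (F α) D h (view α σ) in
      on α q , subst (Edge (F α) (view α σ)) (sym (view-on α q)) e
    glued-isModel α T h σ = frame (F α) T h (view α σ)
    glued-isModel α B h σ σ′ = frame (F α) B h _ _
    glued-isModel α C4 h σ σ′ σ″ = frame (F α) C4 h _ _ _
    glued-isModel α C5 h σ σ′ σ″ = frame (F α) C5 h _ _ _

    truth : ∀ ψ → (∀ {χ} → χ ∈ subL ψ → χ ∈ Γ) → ∀ σ → md ψ ≤ levelˢ σ →
            worldˢ σ ⊩ ψ → _⊨_ glued σ ψ
    truth (var p) c σ l h = h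
    truth (nvar p) c σ l h = h
    truth tt c σ l h = h
    truth (ψ ∧ᶠ χ) c σ l (a , b) =
      truth ψ (c ∘ there ∘ ∈-++⁺ˡ) σ (m⊔n≤o⇒m≤o _ _ l) a ,
      truth χ (c ∘ there ∘ ∈-++⁺ʳ (subL ψ)) σ (m⊔n≤o⇒n≤o _ _ l) b
    truth (ψ ∨ᶠ χ) c σ l (inj₁ a) = inj₁ (truth ψ (c ∘ there ∘ ∈-++⁺ˡ) σ (m⊔n≤o⇒m≤o _ _ l) a)
    truth (ψ ∨ᶠ χ) c σ l (inj₂ b) = inj₂ (truth χ (c ∘ there ∘ ∈-++⁺ʳ (subL ψ)) σ (m⊔n≤o⇒n≤o _ _ l) b)
    truth (⟨ α ⟩ ψ) c σ l h =
      let q , e , a , m = diamond (F α) (view α σ) (inj₂ (c (here refl) , c (there (subL-refl ψ))))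
                            (subst (suc (md ψ) ≤_) (sym (level-view α σ)) l)
                            (subst (_⊩ ⟨ α ⟩ ψ) (sym (world-view α σ)) h)
      in on α q , subst (Edge (F α) (view α σ)) (sym (view-on α q)) e , truth ψ (c ∘ there) (on α q) m a
    truth ([ α ] ψ) c σ l h σ′ e =
      let a , m = box (F α) e (c (here refl) , c (there (subL-refl ψ)))
                    (subst (suc (md ψ) ≤_) (sym (level-view α σ)) l)
                    (subst (_⊩ [ α ] ψ) (sym (world-view α σ)) h)
      in truth ψ (c ∘ there) σ′ (subst (md ψ ≤_) (level-view α σ′) m)
           (subst (_⊩ ψ) (world-view α σ′) a)

    satisfiable : ∀ φ {w} → (∀ {χ} → χ ∈ subL φ → χ ∈ Γ) → Budget (md φ) w → w ⊩ φ → Satisfiable L φ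
    satisfiable φ c b h = glued , glued-isModel , free b , truth φ c (free b) ≤-refl h

  module _ (α : Fin k) where

    Dense : W → W → Set
    Dense w v = ∀ ψ → Boxed α ψ → w ⊩ [ α ] ψ → v ⊩ ψ

    Inherits : W → W → Set
    Inherits w v = ∀ ψ → Boxed α ψ → w ⊩ [ α ] ψ → v ⊩ [ α ] ψ

    along : ∀ {w v} → R α w v → Dense w v
    along r _ _ h = h _ r

    -- The edge condition of Lemmon filtration. Inheriting boxes forwards gives transitivity,
    -- backwards euclideanness; symmetry also needs `Dense` backwards. On transitive frames B
    -- implies 5, so B asks for backward inheritance too.
    Link : W → W → Set
    Link v u = Inherits v u × Dense v u ×
               ((L α C5 ≡ true) ⊎ (L α B ≡ true) → Inherits u v) × (L α B ≡ true → Dense u v)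

    -- Here u is a cluster point and v the root or another cluster point. The boxes of u are
    -- compared with `⟨ α ⟩ [ α ] ψ` at v, because a root may satisfy more boxes than its cluster.
    -- The last three implications concern u alone and let it act as a source in turn.
    Cluster : W → W → Set
    Cluster v u = ∀ ψ → Boxed α ψ →
      (v ⊩ [ α ] ψ → u ⊩ ψ) ×
      (v ⊩ ⟨ α ⟩ [ α ] ψ → u ⊩ [ α ] ψ) × (u ⊩ [ α ] ψ → v ⊩ ⟨ α ⟩ [ α ] ψ) ×
      (u ⊩ [ α ] ψ → u ⊩ ⟨ α ⟩ [ α ] ψ) × (u ⊩ ⟨ α ⟩ [ α ] ψ → u ⊩ [ α ] ψ) ×
      (u ⊩ [ α ] ψ → u ⊩ ψ)

  -- The largest edge relation that respects boxes, for logics between K and DTB.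
  module Local (α : Fin k)
    (step : ∀ {m w v} → Budget (suc m) w → R α w v → Budget m v)
    (serial : L α D ≡ true → ∀ {m w} → Budget (suc m) w → ∃ (R α w))
    (reflexive : L α T ≡ true → ∀ {m w} → Budget (suc m) w → Dense α w w)
    (symmetric : L α B ≡ true → ∀ {m w v} → Budget (suc m) w → R α w v → Dense α v w)
    (no-4 : L α C4 ≡ false) (no-5 : L α C5 ≡ false) where

    record Point : Set where
      constructor point
      field
        {level} : ℕ
        {world} : W
        budget  : Budget level world
    open Point

    Forth : Point → Point → Set
    Forth p q = level p ≤ suc (level q) × (1 ≤ level p → Dense α (world p) (world q))

    Edge : Point → Point → Set
    Edge p q = Forth p q × (L α B ≡ true → Forth q p)

    down : ∀ {m w v} (b : Budget (suc m) w) (r : R α w v) → Edge (point b) (point (step b r))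
    down b r = (≤-refl , λ _ → along α r) ,
               λ hB → ≤-trans (n≤1+n _) (n≤1+n _) , λ _ → symmetric hB b r

    bottom : ∀ p → level p ≡ 0 → Edge p p
    bottom (point {zero} _) refl = (z≤n , λ ()) , λ _ → z≤n , λ ()

    frame : ∀ c → L α c ≡ true → Holds c Edge
    -- At level 0 no budget is left for a successor. A loop takes its place, harmlessly, as no box
    -- has to be respected there.
    frame D h p@(point {zero} _) = p , bottom p refl
    frame D h (point {suc _} b) = let v , r = serial h b in point (step b r) , down b r
    frame T h p@(point {zero} _) = bottom p refl
    frame T h (point {suc _} b) = forth , λ _ → forth
      where forth = n≤1+n _ , λ _ → reflexive h b
    frame B h p q (pq , qp) = qp h , λ _ → pq
    frame C4 h = case trans (sym no-4) h of λ ()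
    frame C5 h = case trans (sym no-5) h of λ ()

    diamond : ∀ p {ψ} → Requested α ψ → suc (md ψ) ≤ level p → world p ⊩ ⟨ α ⟩ ψ →
              Σ Point λ q → Edge p q × (world q ⊩ ψ) × md ψ ≤ level q
    diamond (point {suc _} b) _ (s≤s l) (v , r , h) = point (step b r) , down b r , h , l

    agentFrame : AgentFrame α
    agentFrame = record
      { Point = Point ; level = level ; world = world ; Edge = Edge ; budget = budget ; start = point
      ; level-start = λ _ → refl ; world-start = λ _ → refl ; frame = frame
      ; box = λ ((l , d) , _) bx m h → d (≤-trans (s≤s z≤n) m) _ bx h , s≤s⁻¹ (≤-trans m l)
      ; diamond = diamond }

  -- Lemmon filtration, for logics that are transitive.  Along a run of α-edges the level
  -- drops at the first edge only, since every later point is already seen from the start of the run.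
  module Transitive (α : Fin k)
    (Anchored : ℕ → W → Set)
    (anchor : ∀ {m w} → Budget (suc m) w → Anchored m w)
    (budget′ : ∀ {m w} → Anchored m w → Budget m w)
    (serve : ∀ {m v ψ} → Anchored m v → Requested α ψ → v ⊩ ⟨ α ⟩ ψ →
             ∃ λ u → Anchored m u × Link α v u × (u ⊩ ψ))
    (serial : L α D ≡ true → Holds D (R α))
    (reflexive : L α T ≡ true → Holds T (R α)) where

    data Point : Set where
      free     : ∀ {l w} → Budget l w → Point
      anchored : ∀ {m w} → Anchored m w → Point

    level top : Point → ℕ
    level (free {l} _) = l
    level (anchored {m} _) = m
    top (free {l} _) = l
    top (anchored {m} _) = suc m

    world : Point → W
    world (free {_} {w} _) = w
    world (anchored {_} {w} _) = w

    level≤top : ∀ p → level p ≤ top p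
    level≤top (free _) = ≤-refl
    level≤top (anchored _) = n≤1+n _

    top≤1+level : ∀ p → top p ≤ suc (level p)
    top≤1+level (free _) = n≤1+n _
    top≤1+level (anchored _) = ≤-refl

    -- Equality of `top` is an equivalence, so the bookkeeping never obstructs transitivity,
    -- symmetry or euclideanness, while the level can still drop by one.
    Edge : Point → Point → Set
    Edge p q = top p ≡ top q × (1 ≤ top p → Link α (world p) (world q))

    base : ∀ p → (top p ≡ 0) ⊎ (∃ λ m → top p ≡ suc m × Anchored m (world p))
    base (free {zero} b) = inj₁ refl
    base (free {suc m} b) = inj₂ (m , refl , anchor b)
    base (anchored {m} a) = inj₂ (m , refl , a)

    bottom : ∀ p → top p ≡ 0 → Edge p p
    bottom p e = refl , λ l → case subst (1 ≤_) e l of λ ()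

    frame : ∀ c → L α c ≡ true → Holds c Edge
    frame D h p with base p
    ... | inj₁ e = p , bottom p e
    ... | inj₂ (m , e , a) =
      let v , r = serial h (world p)
          u , a′ , l , _ = serve a (inj₁ refl) (v , r , tt)
      in anchored a′ , e , λ _ → l
    frame T h p = refl , λ _ → (λ _ _ → id) , dense , (λ _ _ _ → id) , λ _ → dense
      where dense : Dense α (world p) (world p)
            dense = along α (reflexive h (world p))
    frame B h p q (e , l) = sym e , λ t →
      let i , d , j , d′ = l (subst (1 ≤_) (sym e) t) in j (inj₂ h) , d′ h , (λ _ → i) , λ _ → d
    frame C4 h p q s (e , l) (e′ , l′) = trans e e′ , λ t →
      let i , d , j , d′ = l t
          i′ , d″ , j′ , d‴ = l′ (subst (1 ≤_) e t)
      in (λ χ b → i′ χ b ∘ i χ b) , (λ χ b → d″ χ b ∘ i χ b) , (λ s χ b → j s χ b ∘ j′ s χ b) ,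
         (λ hB χ b → d′ hB χ b ∘ j′ (inj₂ hB) χ b)
    frame C5 h p q s (e , l) (e′ , l′) = trans (sym e) e′ , λ t →
      let i , d , j , d′ = l (subst (1 ≤_) (sym e) t)
          i′ , d″ , j′ , d‴ = l′ (subst (1 ≤_) (sym e) t)
      in (λ χ b → i′ χ b ∘ j (inj₁ h) χ b) , (λ χ b → d″ χ b ∘ j (inj₁ h) χ b) ,
         (λ _ χ b → i χ b ∘ j′ (inj₁ h) χ b) , (λ _ χ b → d χ b ∘ j′ (inj₁ h) χ b)

    diamond : ∀ p {ψ} → Requested α ψ → suc (md ψ) ≤ level p → world p ⊩ ⟨ α ⟩ ψ →
              Σ Point λ q → Edge p q × (world q ⊩ ψ) × md ψ ≤ level q
    diamond p rq l h with base p
    ... | inj₁ e = case ≤-trans l (≤-trans (level≤top p) (≤-reflexive e)) of λ ()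
    ... | inj₂ (m , e , a) =
      let u , a′ , k , h′ = serve a rq h
      in anchored a′ , (e , λ _ → k) , h′ , s≤s⁻¹ (≤-trans l (≤-trans (level≤top p) (≤-reflexive e)))

    budget : ∀ p → Budget (level p) (world p)
    budget (free b) = b
    budget (anchored a) = budget′ a

    agentFrame : AgentFrame α
    agentFrame = record
      { Point = Point ; level = level ; world = world ; Edge = Edge ; budget = budget ; start = free
      ; level-start = λ _ → refl ; world-start = λ _ → refl ; frame = frame
      ; box = λ {p} {q} (e , k) bx m h →
          let t = ≤-trans m (level≤top p) in
          proj₁ (proj₂ (k (≤-trans (s≤s z≤n) t))) _ bx h ,
          s≤s⁻¹ (≤-trans t (≤-trans (≤-reflexive e) (top≤1+level q)))
      ; diamond = diamond }

  -- A K5-frame generated by one state is a root together with a cluster.  top names the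
  -- level of the root; the cluster consists of successors of the root (level top - 1)
  -- and successors of those (level top - 2).
  module Euclidean (α : Fin k)
    (Good : W → Set)
    (good : ∀ {m w} → Budget m w → Good w)
    (step : ∀ {m w v} → Budget (suc m) w → R α w v → Budget m v)
    (cluster : ∀ {v u} → Good v → Good u → R α v u → Cluster α v u)
    (back : ∀ {z r u ψ} → Good z → Good r → Good u → R α z r → R α r u → Requested α ψ →
            u ⊩ ⟨ α ⟩ ψ → r ⊩ ⟨ α ⟩ ψ)
    (serial : L α D ≡ true → Holds D (R α))
    (no-T : L α T ≡ false) (no-B : L α B ≡ false) (no-4 : L α C4 ≡ false) where

    data Point : Set where
      free   : ∀ {l w} → Budget l w → Point
      inner  : ∀ {m z w} → Good z → R α z w → Budget m w → Point
      outer  : ∀ {m z r w} → Good z → R α z r → Budget (suc m) r → R α r w → Point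

    level top : Point → ℕ
    level (free {l} _) = l
    level (inner {m} _ _ _) = m
    level (outer {m} _ _ _ _) = m
    top (free {l} _) = l
    top (inner {m} _ _ _) = suc m
    top (outer {m} _ _ _ _) = suc (suc m)

    world : Point → W
    world (free {_} {w} _) = w
    world (inner {_} {_} {w} _ _ _) = w
    world (outer {_} {_} {_} {w} _ _ _ _) = w

    budget : ∀ p → Budget (level p) (world p)
    budget (free b) = b
    budget (inner _ _ b) = b
    budget (outer _ _ b r) = step b r

    record Edge (p q : Point) : Set where
      constructor edge
      field
        same-top : top p ≡ top q
        below    : level q ≤ pred (top p)
        above    : top p ≤ suc (suc (level q))
        drop     : level p ≤ suc (level q)
        linked   : 1 ≤ top p → Cluster α (world p) (world q)

    euclid : ∀ {v u z} → Cluster α v u → Cluster α v z → Cluster α u z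
    euclid vu vz χ b =
      let a₁ , a₂ , a₃ , a₄ , a₅ , a₆ = vu χ b
          b₁ , b₂ , b₃ , b₄ , b₅ , b₆ = vz χ b
      in b₆ ∘ b₂ ∘ a₃ , b₂ ∘ a₃ ∘ a₅ , a₄ ∘ a₂ ∘ b₃ , b₄ , b₅ , b₆

    edge-euclid : ∀ {p q s} → Edge p q → Edge p s → Edge q s
    edge-euclid {p} {q} {s} (edge e l m n c) (edge e′ l′ m′ n′ c′) = edge
      (trans (sym e) e′)
      (subst (λ t → level s ≤ pred t) e l′)
      (subst (_≤ suc (suc (level s))) e m′)
      -- The level of q is at most `pred (top p)`, that of s at least `top p` minus two; hence q
      -- lies at most one level above s.
      (≤-trans l (pred-mono-≤ m′))
      λ t → let t′ = subst (1 ≤_) (sym e) t in euclid (c t′) (c′ t′)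

    free⇒inner : ∀ {m w v} (b : Budget (suc m) w) (r : R α w v) →
                 Edge (free b) (inner (good b) r (step b r))
    free⇒inner b r = edge refl ≤-refl (n≤1+n _) ≤-refl λ _ → cluster (good b) (good (step b r)) r

    inner⇒outer : ∀ {m z w v} (g : Good z) (s : R α z w) (b : Budget (suc m) w) (r : R α w v) →
                  Edge (inner g s b) (outer g s b r)
    inner⇒outer g s b r = edge refl (n≤1+n _) ≤-refl ≤-refl λ _ → cluster (good b) (good (step b r)) r

    frame : ∀ c → L α c ≡ true → Holds c Edge
    frame D h p@(free {zero} b) = p , edge refl z≤n z≤n z≤n λ ()
    frame D h (free {suc m} {w} b) = let v , r = serial h w in _ , free⇒inner b r
    -- Cluster points may be made reflexive: euclideanness applies to an edge paired with itself.
    frame D h p@(inner g r b) = p , edge refl ≤-refl (n≤1+n _) (n≤1+n _)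
      λ _ → let c = cluster g (good b) r in euclid c c
    frame D h p@(outer g s b r) = p , edge-euclid e e
      where e = inner⇒outer g s b r
    frame T h = case trans (sym no-T) h of λ ()
    frame B h = case trans (sym no-B) h of λ ()
    frame C4 h = case trans (sym no-4) h of λ ()
    frame C5 h p q s e e′ = edge-euclid e e′

    diamond : ∀ p {ψ} → Requested α ψ → suc (md ψ) ≤ level p → world p ⊩ ⟨ α ⟩ ψ →
              Σ Point λ q → Edge p q × (world q ⊩ ψ) × md ψ ≤ level q
    diamond (free {suc m} b) _ (s≤s l) (v , r , h) = _ , free⇒inner b r , h , l
    diamond (inner {suc m} g s b) _ (s≤s l) (v , r , h) = _ , inner⇒outer g s b r , h , l
    diamond (outer g s b r) rq l h =
      -- A further step in M would cost budget. The diamond is moved back to the predecessor of the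
      -- outer point instead, whose witness is an outer point of the same level, joined to the first
      -- by euclideanness.
      let v , r′ , h′ = back g (good b) (good (step b r)) s r rq h
      in outer g s b r′ , edge-euclid (inner⇒outer g s b r) (inner⇒outer g s b r′) , h′ , <⇒≤ l

    agentFrame : AgentFrame α
    agentFrame = record
      { Point = Point ; level = level ; world = world ; Edge = Edge ; budget = budget ; start = free
      ; level-start = λ _ → refl ; world-start = λ _ → refl ; frame = frame
      ; box = λ {p} (edge _ _ _ n c) bx m h →
          proj₁ (c (≤-trans (s≤s z≤n) (≤-trans m (level≤top p))) _ bx) h , s≤s⁻¹ (≤-trans m n)
      ; diamond = diamond }
      where
      level≤top : ∀ p → level p ≤ top p
      level≤top (free _) = ≤-refl
      level≤top (inner _ _ _) = n≤1+n _
      level≤top (outer _ _ _ _) = ≤-trans (n≤1+n _) (n≤1+n _)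

-- Witnesses from the axioms

module Repair (em : ExcludedMiddle 0ℓ) {k n : ℕ} (A : Agents k) (x : Cond) (L₁ L₂ : Logic k)
  (L₁-on : ∀ α c → A α ≡ true → L₁ α c ≡ (L₂ α c ∨ (c ==ᶜ x)))
  (L₁-off : ∀ α c → A α ≡ false → L₁ α c ≡ L₂ α c)
  (L₂-precedes : ∀ α c → L₂ α c ≡ true → c precedes x)
  (φ : Form k n) (M : Model k n) (M-isModel : IsModelOf L₂ M) where

  open Model M
  open Classical em M

  Γ : List (Form k n)
  Γ = sub φ

  Ax : W → Set
  Ax = Axioms A x φ

  open Glue M Γ L₁ using (AgentFrame)

  origin : ∀ α c → L₁ α c ≡ true → (L₂ α c ≡ true) ⊎ (A α ≡ true × c ≡ x)
  origin α c h with A α in e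
  ... | false = inj₁ (trans (sym (L₁-off α c e)) h)
  ... | true with Equivalence.to T-∨ (Equivalence.from T-≡ (trans (sym (L₁-on α c e)) h))
  ... | inj₁ t = inj₁ (Equivalence.to T-≡ t)
  ... | inj₂ t = inj₂ (refl , ==ᶜ-sound c x t)

  holds : ∀ {α c} → L₁ α c ≡ true → Holds c (R α) ⊎ (A α ≡ true × c ≡ x)
  holds {α} {c} h = [ inj₁ ∘ M-isModel α c , inj₂ ]′ (origin α c h)

  holds-≢ : ∀ {α c} → c ≢ x → L₁ α c ≡ true → Holds c (R α)
  holds-≢ c≢x h = [ id , (λ (_ , e) → contradiction e c≢x) ]′ (holds h)

  absent : ∀ {α c} → ¬ (c precedes x) → (A α ≡ true → c ≢ x) → L₁ α c ≡ false
  absent {α} {c} ¬p c≢x = ¬-not λ h →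
    [ ¬p ∘ L₂-precedes α c , (λ (a , e) → c≢x a e) ]′ (origin α c h)

  instance-of : ∀ {α c χ w} → c ≡ x → A α ≡ true → Ax w → χ ∈ subBar φ → w ⊩ ax c α χ
  instance-of {α} {c} {χ} {w} e Aα a m = subst (λ c → w ⊩ ax c α χ) (sym e) (a α χ Aα m)

  Γ⊆subBar : ∀ {χ} → χ ∈ Γ → χ ∈ subBar φ
  Γ⊆subBar = ∈-++⁺ˡ

  neg-Γ⊆subBar : ∀ {χ} → χ ∈ Γ → neg χ ∈ subBar φ
  neg-Γ⊆subBar m = ∈-++⁺ʳ Γ (∈-map⁺ neg m)

  -- Each of D, T and B in `L₁ α` either holds in M already or is the new condition x, and then the
  -- axiom at the current world does its work.
  localFrame : ∀ {Budget} → (∀ {m w} → Budget m w → Ax w) →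
    ∀ {α} → (∀ {m w v} → Budget (suc m) w → R α w v → Budget m v) →
    L₁ α C4 ≡ false → L₁ α C5 ≡ false → AgentFrame Budget α
  localFrame {Budget} now {α} step no-4 no-5 = Local.agentFrame α step serial reflexive symmetric no-4 no-5
    where
    open Glue M Γ L₁ Budget using (module Local; Dense; along)
    serial : L₁ α D ≡ true → ∀ {m w} → Budget (suc m) w → ∃ (R α w)
    serial h {w = w} b with holds h
    ... | inj₁ s = s w
    -- The axiom for D does not depend on the substituted formula; φ merely names an instance.
    ... | inj₂ (a , e) = let v , r , _ = instance-of e a (now b) (Γ⊆subBar (subL⊆sub φ (subL-refl φ))) in v , r
    reflexive : L₁ α T ≡ true → ∀ {m w} → Budget (suc m) w → Dense α w w
    reflexive h {w = w} b ψ (bx , ψ∈) with holds h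
    ... | inj₁ r = along α (r w) ψ (bx , ψ∈)
    ... | inj₂ (a , e) = ⇒-elim ([ α ] ψ) ψ (instance-of e a (now b) (Γ⊆subBar ψ∈))
    symmetric : L₁ α B ≡ true → ∀ {m w v} → Budget (suc m) w → R α w v → Dense α v w
    symmetric h {w = w} {v} b r ψ (bx , ψ∈) with holds h
    ... | inj₁ s = along α (s w v r) ψ (bx , ψ∈)
    ... | inj₂ (a , e) = λ g → ⇒-elim (⟨ α ⟩ [ α ] ψ) ψ (instance-of e a (now b) (Γ⊆subBar ψ∈)) (v , r , g)

  -- Transitivity: anchored runs paid for by false boxes

  module Four (x≡4 : x ≡ C4) where

    Budget : ℕ → W → Set
    Budget m = Near Ax (m * size φ)

    open Glue M Γ L₁ Budget using (module Transitive; Inherits; Link; Boxed; Requested)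

    four : ∀ {α ψ w} → A α ≡ true → Ax w → ψ ∈ Γ → w ⊩ [ α ] ψ → w ⊩ [ α ] ([ α ] ψ)
    four {α} {ψ} Aα a m =
      ⇒-elim ([ α ] ψ) ([ α ] [ α ] ψ) (instance-of (sym x≡4) Aα a (Γ⊆subBar m))

    no-5 : ∀ {α} → L₁ α C5 ≡ false
    no-5 = absent (λ p → case subst (C5 precedes_) x≡4 p of λ { (s≤s (s≤s (s≤s ()))) })
                  (λ _ e → case trans e x≡4 of λ ())

    Lacks : Fin k → W → Form k n → Set
    Lacks α w χ = ∃ λ ψ → χ ≡ [ α ] ψ × Boxed α ψ × ¬ (w ⊩ [ α ] ψ)

    lacking : Fin k → W → ℕ
    lacking α w = length (filter (λ χ → em {Lacks α w χ}) Γ)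

    -- Some member of Γ is not a box and is never counted. The unit saved pays for the step from an
    -- anchor to a witness.
    lacking<size : ∀ α w → lacking α w < size φ
    lacking<size α w = filter-notAll _ Γ (Any.map nonModal-¬Lacks (nonModal-sub φ))
      where
      nonModal-¬Lacks : ∀ {χ} → NonModal χ → ¬ Lacks α w χ
      nonModal-¬Lacks (var p) (_ , () , _)
      nonModal-¬Lacks (nvar p) (_ , () , _)
      nonModal-¬Lacks tt (_ , () , _)
      nonModal-¬Lacks ff (_ , () , _)

    lacking-< : ∀ α {w v} → Inherits α w v → ¬ Inherits α v w → lacking α v < lacking α w
    lacking-< α {w} {v} i ¬j = filter-⊂ _ _ Γ mono strict
      where
      mono : ∀ χ → Lacks α v χ → Lacks α w χ
      mono χ (ψ , e , b , ¬h) = ψ , e , b , λ h → ¬h (i ψ b h)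
      strict : Any (λ χ → Lacks α w χ × ¬ Lacks α v χ) Γ
      strict with em {Any (λ χ → Lacks α w χ × ¬ Lacks α v χ) Γ}
      ... | yes p = p
      ... | no ¬p = ⊥-elim (¬j λ ψ b h → case em {w ⊩ [ α ] ψ} of λ where
        (yes h′) → h′
        (no ¬h′) → ⊥-elim (¬p (lose (proj₁ b) ((ψ , refl , b , ¬h′) , λ where (_ , refl , _ , ¬h) → ¬h h))))

    module _ {α : Fin k} (Aα : A α ≡ true) where

      -- The anchor r has the same boxes as v. Beyond level m its budget covers one step to a
      -- witness, plus one unit for each box still false at r, which bounds the later changes of
      -- anchor.
      Anchored : ℕ → W → Set
      Anchored m v = ∃ λ r → Near Ax (m * size φ + suc (lacking α r)) r × Budget m v ×
                             Inherits α r v × Inherits α v r × (r ≡ v ⊎ R α r v)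

      anchor : ∀ {m w} → Budget (suc m) w → Anchored m w
      anchor {m} {w} b = w ,
        -- One level is worth |φ| units, at least `suc (lacking α w)`, so w can be its own anchor.
        Near-≤ (≤-trans (+-monoʳ-≤ (m * size φ) (lacking<size α w)) (≤-reflexive (+-comm (m * size φ) _))) b ,
        Near-≤ (m≤n+m (m * size φ) (size φ)) b , (λ _ _ → id) , (λ _ _ → id) , inj₁ refl

      serve : ∀ {m v ψ} → Anchored m v → Requested α ψ → v ⊩ ⟨ α ⟩ ψ →
              ∃ λ u → Anchored m u × Link α v u × (u ⊩ ψ)
      serve {m} {v} {ψ} (r , nr , nv , rv , vr , near) rq h = u , anchored , link , c
        where
        -- When r differs from v, the request `tt` is met at r by v itself; any other request by
        -- shortening two diamonds to one with the axiom for ¬ψ.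
        pull : r ≡ v ⊎ R α r v → Requested α ψ → r ⊩ ⟨ α ⟩ ψ
        pull (inj₁ refl) _ = h
        pull (inj₂ t) (inj₁ refl) = v , t , tt
        pull (inj₂ t) (inj₂ (_ , ψ∈)) =
          dual-4 ψ (instance-of (sym x≡4) Aα (Near-now nr) (neg-Γ⊆subBar ψ∈)) (v , t , h)

        u : W
        u = proj₁ (pull near rq)
        ru : R α r u
        ru = proj₁ (proj₂ (pull near rq))
        c : u ⊩ ψ
        c = proj₂ (proj₂ (pull near rq))

        nu : Near Ax (m * size φ + lacking α r) u
        nu = Near-step (subst (λ j → Near Ax j r) (+-suc (m * size φ) (lacking α r)) nr) ru

        r⊆u : Inherits α r u
        r⊆u ψ (_ , ψ∈) g = four Aα (Near-now nr) ψ∈ g u ru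

        bu : Budget m u
        bu = Near-≤ (m≤m+n (m * size φ) (lacking α r)) nu

        anchored : Anchored m u
        -- If u has no new boxes, r stays the anchor at no cost. Otherwise u takes over: the step
        -- from r used one unit, and the drop of `lacking` leaves one for the next step.
        anchored with em {Inherits α u r}
        ... | yes u⊆r = r , nr , bu , r⊆u , u⊆r , inj₂ ru
        ... | no u⊈r  = u , Near-≤ (+-monoʳ-≤ (m * size φ) (lacking-< α r⊆u u⊈r)) nu , bu ,
                        (λ _ _ → id) , (λ _ _ → id) , inj₁ refl

        sym-R : L₁ α B ≡ true → Holds B (R α)
        sym-R = holds-≢ (λ e → case trans e x≡4 of λ ())

        u⊆r : L₁ α B ≡ true → Inherits α u r
        u⊆r hB ψ (_ , ψ∈) g = four Aα (Near-now nu) ψ∈ g r (sym-R hB r u ru)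

        link : Link α v u
        link = (λ ψ b → r⊆u ψ b ∘ vr ψ b) , (λ ψ b g → vr ψ b g u ru) ,
               (λ { (inj₁ h5) → case trans (sym no-5) h5 of λ ()
                  ; (inj₂ hB) ψ b → rv ψ b ∘ u⊆r hB ψ b }) ,
               λ hB ψ b g → case near of λ where
                 (inj₁ refl) → g r (sym-R hB r u ru)
                 (inj₂ t)    → u⊆r hB ψ b g v t

    agentFrame : ∀ α → AgentFrame Budget α
    agentFrame α with A α in Aα
    ... | true = Transitive.agentFrame α (Anchored Aα) (λ {m} → anchor Aα {m})
                   (λ (_ , _ , b , _) → b) (λ {m} → serve Aα {m})
                   (holds-≢ λ e → case trans e x≡4 of λ ()) (holds-≢ λ e → case trans e x≡4 of λ ())
    ... | false = localFrame {Budget} Near-now (λ {m} → step {m})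
                    (absent (λ p → case subst (C4 precedes_) x≡4 p of λ { (s≤s (s≤s (s≤s ()))) })
                            (λ a → case trans (sym a) Aα of λ ()))
                    no-5
      where
      step : ∀ {m w v} → Budget (suc m) w → R α w v → Budget m v
      -- The inequality only shows that |φ| is positive: of the |φ| units of a level one pays for
      -- the step and the rest are dropped.
      step {m} {v = v} b r with size φ | lacking<size α v
      ... | suc s | _ = Near-≤ (m≤n+m (m * suc s) s) (Near-step b r)

  -- Euclideanness: one anchor per run, or a root with a cluster

  module Five (x≡5 : x ≡ C5) where

    Budget : ℕ → W → Set
    Budget = Near Ax

    open Glue M Γ L₁ Budget
      using (module Transitive; module Euclidean; Inherits; Link; along; Boxed; Requested)

    -- Makes available axiom 5 for χ and, through the instance for the negated box, its dual for
    -- `[ α ] χ`.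
    Usable : Fin k → Form k n → Set
    Usable α χ = χ ∈ subBar φ × neg ([ α ] χ) ∈ subBar φ

    boxed-usable : ∀ {α χ} → Boxed α χ → Usable α χ
    boxed-usable (b , m) = Γ⊆subBar m , neg-Γ⊆subBar b

    diamond-usable : ∀ {α χ} → ⟨ α ⟩ χ ∈ Γ → χ ∈ Γ → Usable α (neg χ)
    diamond-usable {α} {χ} d m =
      neg-Γ⊆subBar m , subst (λ ψ → ⟨ α ⟩ ψ ∈ subBar φ) (sym (neg-involutive χ)) (Γ⊆subBar d)

    base : ∀ {α c} → c ≢ C5 → L₁ α c ≡ true → Holds c (R α)
    base ne = holds-≢ λ e → ne (trans e x≡5)

    module _ {α : Fin k} (Aα : A α ≡ true) where

      five : ∀ {χ w} → Ax w → Usable α χ → w ⊩ ⟨ α ⟩ [ α ] χ → w ⊩ [ α ] χ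
      five {χ} a (m , _) = ⇒-elim (⟨ α ⟩ [ α ] χ) ([ α ] χ) (instance-of (sym x≡5) Aα a m)

      five-dual : ∀ {χ w} → Ax w → Usable α χ → w ⊩ ⟨ α ⟩ [ α ] χ → w ⊩ [ α ] (⟨ α ⟩ [ α ] χ)
      five-dual {χ} a (_ , m) = dual-5 ([ α ] χ) (instance-of (sym x≡5) Aα a m)

      -- The dual axiom at v carries `⟨ α ⟩ [ α ] χ` to every successor, in particular to u, where
      -- axiom 5 turns it into a box.
      successor-boxes : ∀ {χ v u} → Ax v → Ax u → R α v u → Usable α χ →
        (v ⊩ ⟨ α ⟩ [ α ] χ → u ⊩ [ α ] χ) × (u ⊩ [ α ] χ → u ⊩ ⟨ α ⟩ [ α ] χ)
      successor-boxes {χ} {v} {u} av au r us =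
        (λ g → five au us (five-dual av us g u r)) , λ g → five-dual av us (u , r , g) u r

      -- If r had `[ α ] neg ψ`, then, being itself a successor of z, it would have
      -- `⟨ α ⟩ [ α ] neg ψ`, which makes `[ α ] neg ψ` true at u. The predecessor z is essential: a
      -- root may have a box that no successor has.
      back : ∀ {z r u ψ} → Ax z → Ax r → Ax u → R α z r → R α r u → Requested α ψ →
             u ⊩ ⟨ α ⟩ ψ → r ⊩ ⟨ α ⟩ ψ
      back _ _ _ _ ru (inj₁ refl) _ = _ , ru , tt
      back {z} {r} {u} {ψ} az ar au zr ru (inj₂ (d , m)) g with ⊩-em (⟨ α ⟩ ψ) r
      ... | inj₁ h = h
      ... | inj₂ h = ⊥-elim (⊩-contradiction (⟨ α ⟩ ψ) g
                       (proj₁ (successor-boxes ar au ru us) (proj₂ (successor-boxes az ar zr us) h)))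
        where us = diamond-usable d m

      euclideanFrame : L₁ α T ≡ false → L₁ α B ≡ false → L₁ α C4 ≡ false → AgentFrame Budget α
      euclideanFrame = Euclidean.agentFrame α Ax Near-now Near-step
        (λ av au r ψ b → let us = boxed-usable b ; s₁ , s₂ = successor-boxes av au r us in
          (λ g → g _ r) , s₁ , (λ g → _ , r , g) , s₂ , five au us ,
          (λ g → five av us (_ , r , g) _ r))
        back (base λ ())

    -- In contrast to the case of 4, the anchor is never replaced: every witness is again a
    -- successor of the same r, so one spare unit suffices.
    Anchored : Fin k → ℕ → W → Set
    Anchored α m v = ∃ λ r → Near Ax (suc m) r × Near Ax m v × (r ≡ v ⊎ R α r v)

    anchor : ∀ {α m w} → Budget (suc m) w → Anchored α m w
    anchor b = _ , b , Near-≤ (n≤1+n _) b , inj₁ refl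

    -- As 4 precedes 5, M is itself transitive for α; the original successor of v serves and is also
    -- a successor of r.
    serve-4 : ∀ {α m v ψ} → L₁ α C4 ≡ true → Anchored α m v → v ⊩ ⟨ α ⟩ ψ →
              ∃ λ u → Anchored α m u × Link α v u × (u ⊩ ψ)
    serve-4 {α} {m} {v} {ψ} h4 (r , nr , nv , near) (u , s , c) =
      u , (r , nr , Near-step nr ru , inj₂ ru) ,
      ((λ ψ b g y t → g y (trans-R v u y s t)) , along α s , sharp , λ hB ψ b g → g v (base (λ ()) hB v u s)) , c
      where
      trans-R : Holds C4 (R α)
      trans-R = base (λ ()) h4
      ru : R α r u
      ru = case near of λ where
        (inj₁ refl) → s
        (inj₂ t)    → trans-R r v u t s
      sharp : (L₁ α C5 ≡ true) ⊎ (L₁ α B ≡ true) → Inherits α u v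
      sharp (inj₁ h5) ψ b g with holds h5
      ... | inj₁ euc      = λ y t → g y (euc v u y s t)
      ... | inj₂ (Aα , _) = five Aα (Near-now nv) (boxed-usable b) (u , s , g)
      sharp (inj₂ hB) ψ b g y t = g y (trans-R u v y (base (λ ()) hB v u s) t)

    -- With T or B in M, axiom 5 makes r and its successors agree on all usable boxes. Hence a
    -- diamond at v holds at r as well.
    serve-TB : ∀ {α m v ψ} → A α ≡ true → Holds T (R α) ⊎ Holds B (R α) →
               Anchored α m v → Requested α ψ → v ⊩ ⟨ α ⟩ ψ →
               ∃ λ u → Anchored α m u × Link α v u × (u ⊩ ψ)
    serve-TB {α} {m} {v} {ψ} Aα TB (r , nr , nv , near) rq h =
      u , (r , nr , Near-step nr ru , inj₂ ru) , link , c
      where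
      up : ∀ {u m} → R α r u → Near Ax m u → ∀ {χ} → Usable α χ → u ⊩ [ α ] χ → r ⊩ [ α ] χ
      up t _ us g = five Aα (Near-now nr) us (_ , t , g)

      dn : ∀ {u m} → R α r u → Near Ax m u → ∀ {χ} → Usable α χ → r ⊩ [ α ] χ → u ⊩ [ α ] χ
      -- Axiom 5 at u needs a successor of u with the box. Under B it is r; under T, r sees itself,
      -- and the dual axiom transports the diamond to u.
      dn {u} {m} t nu us g = five Aα (Near-now nu) us (case TB of λ where
        (inj₁ hT) → five-dual Aα (Near-now nr) us (r , hT r , g) u t
        (inj₂ hB) → r , hB r u t , g)

      v⇒r : ∀ {χ} → Usable α χ → v ⊩ [ α ] χ → r ⊩ [ α ] χ
      v⇒r us g = case near of λ where
        (inj₁ refl) → g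
        (inj₂ t)    → up t nv us g

      r⇒v : ∀ {χ} → Usable α χ → r ⊩ [ α ] χ → v ⊩ [ α ] χ
      r⇒v us g = case near of λ where
        (inj₁ refl) → g
        (inj₂ t)    → dn t nv us g

      pull : Requested α ψ → r ⊩ ⟨ α ⟩ ψ
      pull (inj₁ refl) = case near of λ where
        (inj₁ refl) → h
        (inj₂ t)    → v , t , tt
      pull (inj₂ (d , m)) with ⊩-em (⟨ α ⟩ ψ) r
      ... | inj₁ g = g
      ... | inj₂ g = ⊥-elim (⊩-contradiction (⟨ α ⟩ ψ) h (r⇒v (diamond-usable d m) g))

      u : W
      u = proj₁ (pull rq)
      ru : R α r u
      ru = proj₁ (proj₂ (pull rq))
      c : u ⊩ ψ
      c = proj₂ (proj₂ (pull rq))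
      nu : Near Ax m u
      nu = Near-step nr ru

      link : Link α v u
      link = (λ ψ b → dn ru nu (boxed-usable b) ∘ v⇒r (boxed-usable b)) ,
             (λ ψ b g → v⇒r (boxed-usable b) g u ru) ,
             (λ _ ψ b → r⇒v (boxed-usable b) ∘ up ru nu (boxed-usable b)) ,
             λ hB ψ b g → case near of λ where
               (inj₁ refl) → g r (base (λ ()) hB r u ru)
               (inj₂ t)    → up ru nu (boxed-usable b) g v t

    -- Together with 5, each of T and B implies 4, so these logics get a transitive frame. On A only
    -- K5 and KD5 are left for the root and cluster construction.
    agentFrame : ∀ α → AgentFrame Budget α
    agentFrame α = choose (L₁ α C4) refl (A α) refl (L₁ α B) refl (L₁ α T) refl
      where
      transitive : (∀ {m v ψ} → Anchored α m v → Requested α ψ → v ⊩ ⟨ α ⟩ ψ →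
                     ∃ λ u → Anchored α m u × Link α v u × (u ⊩ ψ)) → AgentFrame Budget α
      transitive serve = Transitive.agentFrame α (Anchored α) anchor (λ (_ , _ , b , _) → b) serve
                           (base λ ()) (base λ ())

      choose : ∀ c4 → L₁ α C4 ≡ c4 → ∀ a → A α ≡ a → ∀ b → L₁ α B ≡ b → ∀ t → L₁ α T ≡ t →
               AgentFrame Budget α
      choose true h4 _ _ _ _ _ _ = transitive λ a _ → serve-4 h4 a
      choose false h4 false off _ _ _ _ =
        localFrame {Budget} Near-now Near-step h4
          (absent (λ p → <-irrefl refl (subst (C5 precedes_) x≡5 p)) (λ on → case trans (sym on) off of λ ()))
      choose false h4 true on true hB _ _ = transitive (serve-TB on (inj₂ (base (λ ()) hB)))
      choose false h4 true on false _ true hT = transitive (serve-TB on (inj₁ (base (λ ()) hT)))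
      choose false h4 true on false hB false hT = euclideanFrame on hT hB h4

  -- The conditions D, T and B, with local frames for all agents

  module Low (¬4 : ¬ (C4 precedes x)) (x≢4 : x ≢ C4) (x≢5 : x ≢ C5) where

    agentFrame : ∀ α → AgentFrame (Near Ax) α
    agentFrame α = localFrame {Near Ax} Near-now Near-step
      (absent ¬4 λ _ → x≢4 ∘ sym) (absent (λ p → ¬4 (<⇒≤ p)) λ _ → x≢5 ∘ sym)

-- The equivalence, by cases on the added condition

theorem3p4 : ExcludedMiddle 0ℓ → {k n : ℕ} (A : Agents k) (x : Cond) (L₁ L₂ : Logic k)
    → (∀ α c → A α ≡ true → L₁ α c ≡ (L₂ α c ∨ (c ==ᶜ x)))
    → (∀ α c → A α ≡ false → L₁ α c ≡ L₂ α c)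
    → (∀ α c → L₂ α c ≡ true → c precedes x)
    → (φ : Form k n)
    → ((Satisfiable L₁ φ → Satisfiable L₂ (τ A x φ)) × (Satisfiable L₂ (τ A x φ) → Satisfiable L₁ φ))
theorem3p4 em A x L₁ L₂ on off prec φ = forth , λ (M , isM , w , h) → back x refl M isM w h
  where
  L₂⊆L₁ : ∀ α c → L₂ α c ≡ true → L₁ α c ≡ true
  L₂⊆L₁ α c h with A α in e
  ... | true  = trans (on α c e) (cong (_∨ (c ==ᶜ x)) h)
  ... | false = trans (off α c e) h

  forth : Satisfiable L₁ φ → Satisfiable L₂ (τ A x φ)
  forth (M , isM , w , h) = M , (λ α c → isM α c ∘ L₂⊆L₁ α c) , w ,
    τ-intro A x φ h λ v α χ Aα _ → ax-valid x α χ (isM α x (trans (on α x Aα)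
      (trans (cong (L₂ α x ∨_) (==ᶜ-refl x)) (∨-zeroʳ _)))) v
    where open Classical em M

  -- Splitting on a copy `y` of x makes `depthBound` compute, so that the depth of `Inv` is
  -- literally the budget of the chosen construction at level `md φ`.
  back : ∀ y → y ≡ x → ∀ M → IsModelOf L₂ M → ∀ w → _⊨_ M w (τ A y φ) → Satisfiable L₁ φ
  back y e M isM w h = go y e (τ-elim A y φ h)
    where
    open Classical em M using (τ-elim; Near; Axioms)
    open Repair em A x L₁ L₂ on off prec φ M isM
    build : ∀ {Budget} → (∀ α → Glue.AgentFrame M Γ L₁ Budget α) →
            Budget (md φ) w → _⊨_ M w φ → Satisfiable L₁ φ
    build {Budget} F = Glue.satisfiable M Γ L₁ Budget F φ (subL⊆sub φ)
    go : ∀ y → y ≡ x → _⊨_ M w φ × Near (Axioms A y φ) (depthBound y φ) w → Satisfiable L₁ φ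
    go D refl (h , a) = build {Near (Axioms A D φ)} (Low.agentFrame (λ ()) (λ ()) (λ ())) a h
    go T refl (h , a) = build {Near (Axioms A T φ)} (Low.agentFrame (λ { (s≤s ()) }) (λ ()) (λ ())) a h
    go B refl (h , a) = build {Near (Axioms A B φ)} (Low.agentFrame (λ { (s≤s (s≤s ())) }) (λ ()) (λ ())) a h
    go C4 refl (h , a) = build (Four.agentFrame refl) a h
    go C5 refl (h , a) = build (Five.agentFrame refl) a h
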